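{- Let $(r_0,r_1)\in\mathbb{R}^2$. - If $-2<r_0\le -1$ and $-1<r_1\le 0$, then $(0,-1)$ is a cycle of $\tau_{(r_0,r_1)}$. - If $-1\le r_0<0$ and $0\le r_1<1$, then $(0,1)$ is a cycle of $\tau_{(r_0,r_1)}$. Thus, none of these parameters $(r_0,r_1)$ are in $\mathcal{D}_2^{(*)}$.
   Context: For $\mathbf{r}=(r_0,r_1)\in\mathbb{R}^2$, the two-dimensional shift radix system is the map $\tau_{\mathbf{r}}:\mathbb{Z}^2\to\mathbb{Z}^2$, $\tau_{\mathbf{r}}(a_0,a_1)=(a_1,-\lfloor r_0a_0+r_1a_1\rfloor)$. The orbit of $(a_0,a_1)$ is identified with the integer sequence $(a_n)_{n\ge 0}$ where $a_{n+2}=-\lfloor r_0a_n+r_1a_{n+1}\rfloor$ for $n\ge0$. An orbit is ultimately periodic if there are $n_0\ge 0$, $p>0$ with $a_{n+p}=a_n$ for all $n\ge n_0$; in this case $(a_n,\ldots,a_{n+p-1})$ with $n\ge n_0$ is called a cycle of $\tau_{\mathbf{r}}$. $\mathcal{D}_2^{(*)}$ is the set of all $\mathbf{r}\in\mathbb{R}^2$ such that each ultimately periodic orbit of $\tau_{\mathbf{r}}$ ends up in the trivial cycle $(0)$, i.e. satisfies $a_n=0$ for all sufficiently large $n$. -}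

module Defs where

open import Axiom.ExcludedMiddle using (ExcludedMiddle)
open import Data.Empty using (⊥-elim)
open import Data.Fin.Base using (toℕ)
open import Data.Integer.Base as ℤ using (ℤ; 0ℤ; 1ℤ)
import Data.Integer.Properties as ℤₚ
open import Data.Nat.Base as ℕ using (ℕ; zero; suc)
import Data.Nat.Properties as ℕₚ
open import Data.Product.Base using (_×_; _,_; ∃-syntax; proj₁; proj₂)
open import Data.Rational.Base as ℚ using (ℚ; 0ℚ; 1ℚ; ½)
import Data.Rational.Properties as ℚₚ
open import Data.Rational.Solver using (module +-*-Solver)
import Data.Rational.Unnormalised.Base as ℚᵘ
import Data.Rational.Unnormalised.Properties as ℚᵘₚ
open import Data.Sum.Base using (inj₁; inj₂)
open import Data.Vec.Base using (Vec; lookup)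
open import Level using (0ℓ)
open import Relation.Binary.Definitions using (tri<; tri≈; tri>)
open import Relation.Binary.PropositionalEquality
open import Relation.Nullary using (¬_; yes; no)
open import Relation.Unary using (Pred)

open +-*-Solver using (solve; _:=_; _:+_; _:-_; :-_)

-- Real numbers as Cauchy sequences of rationals, with pointwise operations.
-- Equality of reals (the quotient) is not needed below: reals only ever
-- occur in inequalities, which depend on the limits alone.

IsCauchy : (ℕ → ℚ) → Set
IsCauchy x = ∀ ε → 0ℚ ℚ.< ε →
  ∃[ N ] (∀ m n → N ℕ.≤ m → N ℕ.≤ n → ℚ.∣ x m ℚ.- x n ∣ ℚ.< ε)

record ℝ : Set where
  constructor mkℝ
  field
    seq      : ℕ → ℚ
    isCauchy : IsCauchy seq

open ℝ public

private abstract

  half-pos : ∀ {ε} → 0ℚ ℚ.< ε → 0ℚ ℚ.< ½ ℚ.* ε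
  half-pos {ε} ε>0 = subst (ℚ._< ½ ℚ.* ε) (ℚₚ.*-zeroʳ ½) (ℚₚ.*-monoʳ-<-pos ½ ε>0)

  half+half : ∀ ε → ½ ℚ.* ε ℚ.+ ½ ℚ.* ε ≡ ε
  half+half ε = trans (sym (ℚₚ.*-distribʳ-+ ε ½ ½)) (ℚₚ.*-identityˡ ε)

  +-cauchy : ∀ x y → IsCauchy x → IsCauchy y → IsCauchy (λ n → x n ℚ.+ y n)
  +-cauchy x y cx cy ε ε>0 with cx _ (half-pos ε>0) | cy _ (half-pos ε>0)
  ... | N , hx | M , hy = N ℕ.⊔ M , λ m n m≥ n≥ → begin-strict
    ℚ.∣ (x m ℚ.+ y m) ℚ.- (x n ℚ.+ y n) ∣
      ≡⟨ cong ℚ.∣_∣ (solve 4 (λ a b c d →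
           (a :+ b) :- (c :+ d) := (a :- c) :+ (b :- d)) refl (x m) (y m) (x n) (y n)) ⟩
    ℚ.∣ (x m ℚ.- x n) ℚ.+ (y m ℚ.- y n) ∣
      ≤⟨ ℚₚ.∣p+q∣≤∣p∣+∣q∣ (x m ℚ.- x n) (y m ℚ.- y n) ⟩
    ℚ.∣ x m ℚ.- x n ∣ ℚ.+ ℚ.∣ y m ℚ.- y n ∣
      <⟨ ℚₚ.+-mono-<
           (hx m n (ℕₚ.m⊔n≤o⇒m≤o N M m≥) (ℕₚ.m⊔n≤o⇒m≤o N M n≥))
           (hy m n (ℕₚ.m⊔n≤o⇒n≤o N M m≥) (ℕₚ.m⊔n≤o⇒n≤o N M n≥)) ⟩
    ½ ℚ.* ε ℚ.+ ½ ℚ.* ε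
      ≡⟨ half+half ε ⟩
    ε ∎
    where open ℚₚ.≤-Reasoning

  bounded-by : ∀ (x : ℕ → ℚ) N c → 0ℚ ℚ.< c → (∀ m n → N ℕ.≤ m → N ℕ.≤ n → ℚ.∣ x m ℚ.- x n ∣ ℚ.< c) →
    ∃[ B ] 0ℚ ℚ.< B × ∃[ N ] (∀ n → N ℕ.≤ n → ℚ.∣ x n ∣ ℚ.≤ B)
  bounded-by x N c c>0 h = ℚ.∣ x N ∣ ℚ.+ c , B>0 , N , λ n n≥ → begin
    ℚ.∣ x n ∣
      ≡⟨ cong ℚ.∣_∣ (solve 2 (λ a b → a := b :+ (a :- b)) refl (x n) (x N)) ⟩
    ℚ.∣ x N ℚ.+ (x n ℚ.- x N) ∣
      ≤⟨ ℚₚ.∣p+q∣≤∣p∣+∣q∣ (x N) (x n ℚ.- x N) ⟩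
    ℚ.∣ x N ∣ ℚ.+ ℚ.∣ x n ℚ.- x N ∣
      ≤⟨ ℚₚ.+-monoʳ-≤ ℚ.∣ x N ∣ (ℚₚ.<⇒≤ (h n N n≥ ℕₚ.≤-refl)) ⟩
    ℚ.∣ x N ∣ ℚ.+ c ∎
    where
    open ℚₚ.≤-Reasoning
    B>0 : 0ℚ ℚ.< ℚ.∣ x N ∣ ℚ.+ c
    B>0 = begin-strict
      0ℚ               ≤⟨ ℚₚ.0≤∣p∣ (x N) ⟩
      ℚ.∣ x N ∣        ≡⟨ sym (ℚₚ.+-identityʳ ℚ.∣ x N ∣) ⟩
      ℚ.∣ x N ∣ ℚ.+ 0ℚ <⟨ ℚₚ.+-monoʳ-< ℚ.∣ x N ∣ c>0 ⟩
      ℚ.∣ x N ∣ ℚ.+ c  ∎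

  eventually-bounded : ∀ x → IsCauchy x →
    ∃[ B ] 0ℚ ℚ.< B × ∃[ N ] (∀ n → N ℕ.≤ n → ℚ.∣ x n ∣ ℚ.≤ B)
  eventually-bounded x cx =
    let N , h = cx 1ℚ (ℚₚ.positive⁻¹ 1ℚ) in bounded-by x N 1ℚ (ℚₚ.positive⁻¹ 1ℚ) h

  upper-bound : ∀ p q → 0ℚ ℚ.< p → ∃[ B ] 0ℚ ℚ.< B × p ℚ.≤ B × q ℚ.≤ B
  upper-bound p q p>0 with ℚₚ.≤-total p q
  ... | inj₁ p≤q = q , ℚₚ.<-≤-trans p>0 p≤q , p≤q , ℚₚ.≤-refl
  ... | inj₂ q≤p = p , p>0 , ℚₚ.≤-refl , q≤p

  common-bound : ∀ x y → IsCauchy x → IsCauchy y → ∃[ B ] 0ℚ ℚ.< B × ∃[ K ]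
    (∀ n → K ℕ.≤ n → ℚ.∣ x n ∣ ℚ.≤ B × ℚ.∣ y n ∣ ℚ.≤ B)
  common-bound x y cx cy =
    let X , X>0 , N , hx = eventually-bounded x cx
        Y , _   , M , hy = eventually-bounded y cy
        B , B>0 , X≤B , Y≤B = upper-bound X Y X>0
    in B , B>0 , N ℕ.⊔ M , λ n n≥ →
         ℚₚ.≤-trans (hx n (ℕₚ.m⊔n≤o⇒m≤o N M n≥)) X≤B
       , ℚₚ.≤-trans (hy n (ℕₚ.m⊔n≤o⇒n≤o N M n≥)) Y≤B

  scale : ∀ B ε → 0ℚ ℚ.< B → 0ℚ ℚ.< ε → ∃[ δ ] 0ℚ ℚ.< δ × B ℚ.* δ ≡ ε
  scale B ε B>0 ε>0 = r ℚ.* ε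
    , subst (ℚ._< r ℚ.* ε) (ℚₚ.*-zeroʳ r) (ℚₚ.*-monoʳ-<-pos r {{ℚₚ.1/pos⇒pos B {{ℚ.positive B>0}}}} ε>0)
    , trans (sym (ℚₚ.*-assoc B r ε))
        (trans (cong (ℚ._* ε) (ℚₚ.*-inverseʳ B)) (ℚₚ.*-identityˡ ε))
    where
    instance
      B≢0 : ℚ.NonZero B
      B≢0 = ℚₚ.pos⇒nonZero B {{ℚ.positive B>0}}
    r : ℚ
    r = ℚ.1/ B

  *-bound : ∀ p q B δ {η} → 0ℚ ℚ.< B → B ℚ.* δ ≡ η →
    ℚ.∣ p ∣ ℚ.≤ B → ℚ.∣ q ∣ ℚ.< δ → ℚ.∣ p ℚ.* q ∣ ℚ.< η
  *-bound p q B δ {η} B>0 Bδ p≤ q< = begin-strict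
    ℚ.∣ p ℚ.* q ∣        ≡⟨ ℚₚ.∣p*q∣≡∣p∣*∣q∣ p q ⟩
    ℚ.∣ p ∣ ℚ.* ℚ.∣ q ∣  ≤⟨ ℚₚ.*-monoʳ-≤-nonNeg ℚ.∣ q ∣ {{ℚₚ.∣-∣-nonNeg q}} p≤ ⟩
    B ℚ.* ℚ.∣ q ∣        <⟨ ℚₚ.*-monoʳ-<-pos B {{ℚ.positive B>0}} q< ⟩
    B ℚ.* δ              ≡⟨ Bδ ⟩
    η                    ∎
    where open ℚₚ.≤-Reasoning

  *-telescope : ∀ a b c d → a ℚ.* b ℚ.- c ℚ.* d ≡ a ℚ.* (b ℚ.- d) ℚ.+ d ℚ.* (a ℚ.- c)
  *-telescope a b c d = begin
    a ℚ.* b ℚ.- c ℚ.* d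
      ≡⟨ solve 3 (λ p q s → p :- s := (p :- q) :+ (q :- s)) refl (a ℚ.* b) (a ℚ.* d) (c ℚ.* d) ⟩
    (a ℚ.* b ℚ.- a ℚ.* d) ℚ.+ (a ℚ.* d ℚ.- c ℚ.* d)
      ≡⟨ cong₂ (λ u v → (a ℚ.* b ℚ.- u) ℚ.+ v) refl
           (cong₂ ℚ._-_ (ℚₚ.*-comm a d) (ℚₚ.*-comm c d)) ⟩
    (a ℚ.* b ℚ.- a ℚ.* d) ℚ.+ (d ℚ.* a ℚ.- d ℚ.* c)
      ≡⟨ cong₂ ℚ._+_ (factor a b d) (factor d a c) ⟩
    a ℚ.* (b ℚ.- d) ℚ.+ d ℚ.* (a ℚ.- c) ∎
    where
    open ≡-Reasoning
    factor : ∀ p q r → p ℚ.* q ℚ.- p ℚ.* r ≡ p ℚ.* (q ℚ.- r)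
    factor p q r = trans (cong (p ℚ.* q ℚ.+_) (ℚₚ.neg-distribʳ-* p r))
      (sym (ℚₚ.*-distribˡ-+ p q (ℚ.- r)))

  *-close : ∀ B δ ε {a b c d} → 0ℚ ℚ.< B → B ℚ.* δ ≡ ½ ℚ.* ε →
    ℚ.∣ a ∣ ℚ.≤ B → ℚ.∣ d ∣ ℚ.≤ B → ℚ.∣ a ℚ.- c ∣ ℚ.< δ → ℚ.∣ b ℚ.- d ∣ ℚ.< δ →
    ℚ.∣ a ℚ.* b ℚ.- c ℚ.* d ∣ ℚ.< ε
  *-close B δ ε {a} {b} {c} {d} B>0 Bδ a≤ d≤ a-c b-d = begin-strict
    ℚ.∣ a ℚ.* b ℚ.- c ℚ.* d ∣
      ≡⟨ cong ℚ.∣_∣ (*-telescope a b c d) ⟩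
    ℚ.∣ a ℚ.* (b ℚ.- d) ℚ.+ d ℚ.* (a ℚ.- c) ∣
      ≤⟨ ℚₚ.∣p+q∣≤∣p∣+∣q∣ (a ℚ.* (b ℚ.- d)) (d ℚ.* (a ℚ.- c)) ⟩
    ℚ.∣ a ℚ.* (b ℚ.- d) ∣ ℚ.+ ℚ.∣ d ℚ.* (a ℚ.- c) ∣
      <⟨ ℚₚ.+-mono-< (*-bound a (b ℚ.- d) B δ B>0 Bδ a≤ b-d)
                     (*-bound d (a ℚ.- c) B δ B>0 Bδ d≤ a-c) ⟩
    ½ ℚ.* ε ℚ.+ ½ ℚ.* ε
      ≡⟨ half+half ε ⟩
    ε ∎
    where open ℚₚ.≤-Reasoning

  *-cauchy : ∀ x y → IsCauchy x → IsCauchy y → IsCauchy (λ n → x n ℚ.* y n)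
  *-cauchy x y cx cy ε ε>0 =
    let B , B>0 , K , bd = common-bound x y cx cy
        δ , δ>0 , Bδ     = scale B (½ ℚ.* ε) B>0 (half-pos ε>0)
        N , hx           = cx δ δ>0
        M , hy           = cy δ δ>0
    in K ℕ.⊔ (N ℕ.⊔ M) , λ m n m≥ n≥ →
    let m≥′ = ℕₚ.m⊔n≤o⇒n≤o K (N ℕ.⊔ M) m≥
        n≥′ = ℕₚ.m⊔n≤o⇒n≤o K (N ℕ.⊔ M) n≥
    in *-close B δ ε {x m} {y m} {x n} {y n} B>0 Bδ
         (proj₁ (bd m (ℕₚ.m⊔n≤o⇒m≤o K (N ℕ.⊔ M) m≥)))
         (proj₂ (bd n (ℕₚ.m⊔n≤o⇒m≤o K (N ℕ.⊔ M) n≥)))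
         (hx m n (ℕₚ.m⊔n≤o⇒m≤o N M m≥′) (ℕₚ.m⊔n≤o⇒m≤o N M n≥′))
         (hy m n (ℕₚ.m⊔n≤o⇒n≤o N M m≥′) (ℕₚ.m⊔n≤o⇒n≤o N M n≥′))

infixl 7 _*_
infixl 6 _+_
infix  4 _<_ _≤_

_+_ : ℝ → ℝ → ℝ
x + y = mkℝ (λ n → seq x n ℚ.+ seq y n)
  (+-cauchy (seq x) (seq y) (isCauchy x) (isCauchy y))

_*_ : ℝ → ℝ → ℝ
x * y = mkℝ (λ n → seq x n ℚ.* seq y n)
  (*-cauchy (seq x) (seq y) (isCauchy x) (isCauchy y))

fromℚ : ℚ → ℝ
fromℚ q = mkℝ (λ _ → q) λ ε ε>0 → 0 , λ _ _ _ _ →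
  subst (ℚ._< ε) (sym (cong ℚ.∣_∣ (ℚₚ.+-inverseʳ q))) ε>0

fromℤ : ℤ → ℝ
fromℤ k = fromℚ (k ℚ./ 1)

-- The gap ε is uniform; an eventually pointwise strict inequality would only
-- give ≤ between the limits.
_<_ : ℝ → ℝ → Set
x < y = ∃[ ε ] 0ℚ ℚ.< ε × ∃[ N ] (∀ n → N ℕ.≤ n → seq x n ℚ.+ ε ℚ.≤ seq y n)

_≤_ : ℝ → ℝ → Set
x ≤ y = ¬ (y < x)

-- Floor.  Constructively there is no floor function ℝ → ℤ, so ⌊ x ⌋ = k is a
-- relation between x and k.  It is single-valued, and total under excluded
-- middle (floor-unique, floor-exists).

IsFloor : ℝ → ℤ → Set
IsFloor x k = fromℤ k ≤ x × x < fromℤ (ℤ.suc k)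

private abstract

  /1-mono : ∀ {i j} → i ℤ.≤ j → i ℚ./ 1 ℚ.≤ j ℚ./ 1
  /1-mono {i} {j} i≤j = ℚₚ.toℚᵘ-cancel-≤
    (ℚᵘₚ.≤-respˡ-≃ (ℚᵘₚ.≃-sym (ℚₚ.toℚᵘ-fromℚᵘ (ℚᵘ.mkℚᵘ i 0)))
      (ℚᵘₚ.≤-respʳ-≃ (ℚᵘₚ.≃-sym (ℚₚ.toℚᵘ-fromℚᵘ (ℚᵘ.mkℚᵘ j 0)))
        (ℚᵘ.*≤* (ℤₚ.*-monoʳ-≤-nonNeg 1ℤ i≤j))))

  <-fromℤ : ∀ x {i j} → x < fromℤ i → i ℤ.≤ j → x < fromℤ j
  <-fromℤ x (ε , ε>0 , N , h) i≤j =
    ε , ε>0 , N , λ n n≥ → ℚₚ.≤-trans (h n n≥) (/1-mono i≤j)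

floor-unique : ∀ x {k l} → IsFloor x k → IsFloor x l → k ≡ l
floor-unique x {k} {l} (k≤x , x<k+1) (l≤x , x<l+1) with ℤₚ.<-cmp k l
... | tri< k<l _ _ = ⊥-elim (l≤x (<-fromℤ x x<k+1 (ℤₚ.i<j⇒suc[i]≤j k<l)))
... | tri≈ _ k≡l _ = k≡l
... | tri> _ _ l<k = ⊥-elim (k≤x (<-fromℤ x x<l+1 (ℤₚ.i<j⇒suc[i]≤j l<k)))

private abstract

  p≤∣p∣ : ∀ p → p ℚ.≤ ℚ.∣ p ∣
  p≤∣p∣ p with ℚₚ.≤-total 0ℚ p
  ... | inj₁ 0≤p = ℚₚ.≤-reflexive (sym (ℚₚ.0≤p⇒∣p∣≡p 0≤p))
  ... | inj₂ p≤0 = ℚₚ.≤-trans p≤0 (ℚₚ.0≤∣p∣ p)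

  ≤-↥ : ∀ p → p ℚ.≤ (ℤ.+ ℤ.∣ ℚ.↥ p ∣) ℚ./ 1
  ≤-↥ p@(ℚ.mkℚ n d-1 _) = ℚₚ.toℚᵘ-cancel-≤
    (ℚᵘₚ.≤-respʳ-≃ (ℚᵘₚ.≃-sym (ℚₚ.toℚᵘ-fromℚᵘ (ℚᵘ.mkℚᵘ (ℤ.+ ℤ.∣ n ∣) 0)))
      (ℚᵘ.*≤* (go n)))
    where
    go : ∀ n → n ℤ.* 1ℤ ℤ.≤ (ℤ.+ ℤ.∣ n ∣) ℤ.* (ℤ.+ suc d-1)
    go (ℤ.+ n)      = ℤₚ.*-monoˡ-≤-nonNeg (ℤ.+ n) (ℤ.+≤+ (ℕ.s≤s ℕ.z≤n))
    go ℤ.-[1+ n ] = ℤ.-≤+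

  ↥-≤ : ∀ p → (ℤ.- (ℤ.+ ℤ.∣ ℚ.↥ p ∣)) ℚ./ 1 ℚ.≤ p
  ↥-≤ p@(ℚ.mkℚ n d-1 _) = ℚₚ.toℚᵘ-cancel-≤
    (ℚᵘₚ.≤-respˡ-≃ (ℚᵘₚ.≃-sym (ℚₚ.toℚᵘ-fromℚᵘ (ℚᵘ.mkℚᵘ (ℤ.- (ℤ.+ ℤ.∣ n ∣)) 0)))
      (ℚᵘ.*≤* (go n)))
    where
    go : ∀ n → (ℤ.- (ℤ.+ ℤ.∣ n ∣)) ℤ.* (ℤ.+ suc d-1) ℤ.≤ n ℤ.* 1ℤ
    go (ℤ.+ zero)   = ℤₚ.≤-refl
    go (ℤ.+ suc n)  = ℤ.-≤+
    go ℤ.-[1+ n ] = ℤₚ.*-monoˡ-≤-nonPos ℤ.-[1+ n ] {1ℤ} {ℤ.+ suc d-1} (ℤ.+≤+ (ℕ.s≤s ℕ.z≤n))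

  bounds-of : ∀ x c N → (∀ n → N ℕ.≤ n → ℚ.∣ seq x n ∣ ℚ.≤ c) →
    ∃[ k ] ∃[ n ] fromℤ k ≤ x × x < fromℤ (k ℤ.+ ℤ.+ n)
  bounds-of x c N h = k , d , k≤x , x<k+d
    where
    open ℚₚ.≤-Reasoning
    k l : ℤ
    k = ℤ.- (ℤ.+ ℤ.∣ ℚ.↥ (ℚ.- c) ∣)
    l = ℤ.+ ℤ.∣ ℚ.↥ (c ℚ.+ 1ℚ) ∣

    d : ℕ
    d = ℤ.∣ ℚ.↥ (ℚ.- c) ∣ ℕ.+ ℤ.∣ ℚ.↥ (c ℚ.+ 1ℚ) ∣

    l≡k+d : l ≡ k ℤ.+ ℤ.+ d
    l≡k+d = +-cancel ℤ.∣ ℚ.↥ (ℚ.- c) ∣ ℤ.∣ ℚ.↥ (c ℚ.+ 1ℚ) ∣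
      where
      +-cancel : ∀ m n → ℤ.+ n ≡ (ℤ.- (ℤ.+ m)) ℤ.+ ℤ.+ (m ℕ.+ n)
      +-cancel m n = sym (trans (sym (ℤₚ.+-assoc (ℤ.- (ℤ.+ m)) (ℤ.+ m) (ℤ.+ n)))
        (trans (cong (ℤ._+ (ℤ.+ n)) (ℤₚ.+-inverseˡ (ℤ.+ m))) (ℤₚ.+-identityˡ (ℤ.+ n))))

    x<k+d : x < fromℤ (k ℤ.+ ℤ.+ d)
    x<k+d = 1ℚ , ℚₚ.positive⁻¹ 1ℚ , N , λ n n≥ → begin
      seq x n ℚ.+ 1ℚ        ≤⟨ ℚₚ.+-monoˡ-≤ 1ℚ (ℚₚ.≤-trans (p≤∣p∣ (seq x n)) (h n n≥)) ⟩
      c ℚ.+ 1ℚ              ≤⟨ ≤-↥ (c ℚ.+ 1ℚ) ⟩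
      l ℚ./ 1               ≤⟨ /1-mono (ℤₚ.≤-reflexive l≡k+d) ⟩
      (k ℤ.+ ℤ.+ d) ℚ./ 1   ∎

    k≤x : fromℤ k ≤ x
    k≤x (ε , ε>0 , M , g) = ℚₚ.<-irrefl refl (begin-strict
      seq x n          ≡⟨ sym (ℚₚ.+-identityʳ _) ⟩
      seq x n ℚ.+ 0ℚ   <⟨ ℚₚ.+-monoʳ-< (seq x n) ε>0 ⟩
      seq x n ℚ.+ ε    ≤⟨ g n (ℕₚ.m≤n⊔m N M) ⟩
      k ℚ./ 1          ≤⟨ ↥-≤ (ℚ.- c) ⟩
      ℚ.- c            ≤⟨ ℚₚ.neg-antimono-≤ (begin
        ℚ.- seq x n        ≤⟨ p≤∣p∣ (ℚ.- seq x n) ⟩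
        ℚ.∣ ℚ.- seq x n ∣  ≡⟨ ℚₚ.∣-p∣≡∣p∣ (seq x n) ⟩
        ℚ.∣ seq x n ∣      ≤⟨ h n (ℕₚ.m≤m⊔n N M) ⟩
        c ∎) ⟩
      ℚ.- (ℚ.- seq x n) ≡⟨ solve 1 (λ a → :- (:- a) := a) refl (seq x n) ⟩
      seq x n ∎)
      where
      n : ℕ
      n = N ℕ.⊔ M

  integer-bounds : ∀ x → ∃[ k ] ∃[ n ] fromℤ k ≤ x × x < fromℤ (k ℤ.+ ℤ.+ n)
  integer-bounds x =
    let c , _ , N , h = eventually-bounded (seq x) (isCauchy x) in bounds-of x c N h

floor-exists : ExcludedMiddle 0ℓ → ∀ x → ∃[ k ] IsFloor x k
floor-exists lem x =
  let k , n , k≤x , x<k+n = integer-bounds x in search n k k≤x x<k+n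
  where
  search : ∀ n k → fromℤ k ≤ x → x < fromℤ (k ℤ.+ ℤ.+ n) → ∃[ k ] IsFloor x k
  search zero    k k≤x x<k = ⊥-elim (k≤x (<-fromℤ x x<k (ℤₚ.≤-reflexive (ℤₚ.+-identityʳ k))))
  search (suc n) k k≤x x<k+n with lem {x < fromℤ (ℤ.suc k)}
  ... | yes x<k+1 = k , k≤x , x<k+1
  ... | no  x≮k+1 = search n (ℤ.suc k) x≮k+1
    (<-fromℤ x x<k+n (ℤₚ.≤-reflexive
      (trans (sym (ℤₚ.+-assoc k 1ℤ (ℤ.+ n))) (cong (ℤ._+ (ℤ.+ n)) (ℤₚ.+-comm k 1ℤ)))))

-- The graph of τ_r : τ[ r ] a ↦ b means τ_r(a) = b.
τ[_]_↦_ : ℝ × ℝ → ℤ × ℤ → ℤ × ℤ → Set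
τ[ r₀ , r₁ ] (a₀ , a₁) ↦ (b₀ , b₁) =
  b₀ ≡ a₁ ×
  ∃[ k ] IsFloor (r₀ * fromℤ a₀ + r₁ * fromℤ a₁) k × b₁ ≡ ℤ.- k

-- The sequence a stands for the orbit (a n , a (1 + n)), n ≥ 0, of (a 0 , a 1).
IsOrbit : ℝ × ℝ → (ℕ → ℤ) → Set
IsOrbit r a = ∀ n → τ[ r ] (a n , a (suc n)) ↦ (a (suc n) , a (suc (suc n)))

PeriodicFrom : (a : ℕ → ℤ) (n₀ p : ℕ) → Set
PeriodicFrom a n₀ p = 0 ℕ.< p × (∀ n → n₀ ℕ.≤ n → a (n ℕ.+ p) ≡ a n)

UltimatelyPeriodic : (ℕ → ℤ) → Set
UltimatelyPeriodic a = ∃[ n₀ ] ∃[ p ] PeriodicFrom a n₀ p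

IsCycle : ℝ × ℝ → ∀ {p} → Vec ℤ p → Set
IsCycle r {p} c = ∃[ a ] IsOrbit r a × ∃[ n₀ ] PeriodicFrom a n₀ p ×
  ∃[ n ] n₀ ℕ.≤ n × (∀ i → lookup c i ≡ a (n ℕ.+ toℕ i))

EventuallyZero : (ℕ → ℤ) → Set
EventuallyZero a = ∃[ n₀ ] (∀ n → n₀ ℕ.≤ n → a n ≡ 0ℤ)

𝒟₂⁽*⁾ : Pred (ℝ × ℝ) 0ℓ
𝒟₂⁽*⁾ r = ∀ a → IsOrbit r a → UltimatelyPeriodic a → EventuallyZero a

{-# OPTIONS --safe #-}
module Submission where

-- For (x , y) = (0 , b) with b = ±1, the values r₀ x + r₁ y and r₀ y + r₁ x are
-- b r₁ and b r₀, so each region says exactly that these have floors 0 and -b,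
-- i.e. that τ swaps (0 , b) and (b , 0).

open import Defs
open import Data.Fin.Base using (toℕ; zero; suc)
open import Data.Integer.Base as ℤ using (ℤ; 0ℤ; 1ℤ; -1ℤ; -[1+_])
open import Data.Nat.Base as ℕ using (ℕ; zero; suc)
import Data.Nat.Properties as ℕₚ
open import Data.Product.Base using (_×_; _,_)
open import Data.Rational.Base as ℚ using (0ℚ; 1ℚ)
import Data.Rational.Properties as ℚₚ
open import Data.Sum.Base using (_⊎_; inj₁; inj₂)
open import Data.Vec.Base using (Vec; _∷_; []; lookup)
open import Relation.Binary.PropositionalEquality
open import Relation.Unary using (_∉_)

periodicFrom-* : ∀ {a n₀ p} → PeriodicFrom a n₀ p →
  ∀ {n} k → n₀ ℕ.≤ n → a (n ℕ.+ k ℕ.* p) ≡ a n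
periodicFrom-* {a} _ {n} zero _ = cong a (ℕₚ.+-identityʳ n)
periodicFrom-* {a} {p = p} per@(_ , a-per) {n} (suc k) n₀≤n = begin
  a (n ℕ.+ (p ℕ.+ k ℕ.* p))  ≡⟨ cong a (ℕₚ.+-assoc n p (k ℕ.* p)) ⟨
  a (n ℕ.+ p ℕ.+ k ℕ.* p)    ≡⟨ periodicFrom-* {a} per k (ℕₚ.m≤n⇒m≤n+o p n₀≤n) ⟩
  a (n ℕ.+ p)                ≡⟨ a-per n n₀≤n ⟩
  a n                        ∎
  where open ≡-Reasoning

-- If `a` vanishes from index `m` on, move `m` periods ahead of `n`: the value stays the same, and
-- since `p` is positive the new index is at least `m`.
periodic∧eventuallyZero⇒0 : ∀ {a n₀ p} → PeriodicFrom a n₀ p → EventuallyZero a →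
  ∀ {n} → n₀ ℕ.≤ n → a n ≡ 0ℤ
periodic∧eventuallyZero⇒0 {a} {p = p} per@(p>0 , _) (m , a≡0) {n} n₀≤n =
  trans (sym (periodicFrom-* {a} per m n₀≤n)) (a≡0 (n ℕ.+ m ℕ.* p) m≤n+m*p)
  where
  m≤n+m*p : m ℕ.≤ n ℕ.+ m ℕ.* p
  m≤n+m*p = ℕₚ.m≤n⇒m≤o+n n (ℕₚ.m≤m*n m p {{ℕ.>-nonZero p>0}})

-- The orbit that witnesses the cycle is itself ultimately periodic. Membership in `𝒟₂⁽*⁾` would
-- make it eventually zero, hence zero on its whole periodic range, which contains the entry at `i`.
nonzero-cycle⇒∉𝒟₂⁽*⁾ : ∀ r {p} (c : Vec ℤ p) i → lookup c i ≢ 0ℤ →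
  IsCycle r c → r ∉ 𝒟₂⁽*⁾
nonzero-cycle⇒∉𝒟₂⁽*⁾ r c i cᵢ≢0 (a , orbit , n₀ , per , n , n₀≤n , c≡a) r∈𝒟 =
  cᵢ≢0 (trans (c≡a i) (periodic∧eventuallyZero⇒0 {a} per
    (r∈𝒟 a orbit (n₀ , _ , per)) (ℕₚ.m≤n⇒m≤n+o (toℕ i) n₀≤n)))

-- Swapping the arguments makes the tail of `alternate x y` definitionally `alternate y x`, so
-- inductions along the orbit just exchange the two values.
alternate : ℤ → ℤ → ℕ → ℤ
alternate x y zero    = x
alternate x y (suc n) = alternate y x n

alternate-periodic : ∀ x y n → alternate x y (n ℕ.+ 2) ≡ alternate x y n
alternate-periodic x y zero    = refl
alternate-periodic x y (suc n) = alternate-periodic y x n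

alternate-orbit : ∀ r {x y} → τ[ r ] (x , y) ↦ (y , x) → τ[ r ] (y , x) ↦ (x , y) →
  IsOrbit r (alternate x y)
alternate-orbit r xy yx zero    = xy
alternate-orbit r xy yx (suc n) = alternate-orbit r yx xy n

swap⇒cycle : ∀ r {x y} → τ[ r ] (x , y) ↦ (y , x) → τ[ r ] (y , x) ↦ (x , y) →
  IsCycle r (x ∷ y ∷ [])
swap⇒cycle r {x} {y} xy yx = alternate x y , alternate-orbit r xy yx , 0 ,
  (ℕ.s≤s ℕ.z≤n , λ n _ → alternate-periodic x y n) ,
  0 , ℕ.z≤n , λ { zero → refl ; (suc zero) → refl }

-- Only the terms of the sequences enter the order. This lets bounds on `r₁` pass to
-- `r₀ * 0 + r₁ * 1`, which agrees with it term by term but is a different real as a record.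
<-resp-≗ : ∀ {x x′ y y′} → seq x ≗ seq x′ → seq y ≗ seq y′ → x < y → x′ < y′
<-resp-≗ x≗x′ y≗y′ (ε , ε>0 , N , x+ε≤y) = ε , ε>0 , N , λ n N≤n →
  subst₂ (λ p q → p ℚ.+ ε ℚ.≤ q) (x≗x′ n) (y≗y′ n) (x+ε≤y n N≤n)

IsFloor-resp-≗ : ∀ {x x′ k} → seq x ≗ seq x′ → IsFloor x k → IsFloor x′ k
IsFloor-resp-≗ {x} {x′} {k} x≗x′ (k≤x , x<1+k) =
  (λ x′<k → k≤x (<-resp-≗ {x′} {x} {fromℤ k} {fromℤ k} (λ n → sym (x≗x′ n)) (λ _ → refl) x′<k)) ,
  <-resp-≗ {x} {x′} {fromℤ (ℤ.suc k)} {fromℤ (ℤ.suc k)} x≗x′ (λ _ → refl) x<1+k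

module _ where
  open import Data.Rational.Solver using (module +-*-Solver)
  open +-*-Solver

  *0+*1 : ∀ p q → p ℚ.* 0ℚ ℚ.+ q ℚ.* 1ℚ ≡ q
  *0+*1 = solve 2 (λ p q → p :* con 0ℚ :+ q :* con 1ℚ := q) refl

  *1+*0 : ∀ p q → p ℚ.* 1ℚ ℚ.+ q ℚ.* 0ℚ ≡ p
  *1+*0 = solve 2 (λ p q → p :* con 1ℚ :+ q :* con 0ℚ := p) refl

  *0+*-1 : ∀ p q → p ℚ.* 0ℚ ℚ.+ q ℚ.* ℚ.- 1ℚ ≡ ℚ.- q
  *0+*-1 = solve 2 (λ p q → p :* con 0ℚ :+ q :* con (ℚ.- 1ℚ) := :- q) refl

  *-1+*0 : ∀ p q → p ℚ.* ℚ.- 1ℚ ℚ.+ q ℚ.* 0ℚ ≡ ℚ.- p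
  *-1+*0 = solve 2 (λ p q → p :* con (ℚ.- 1ℚ) :+ q :* con 0ℚ := :- p) refl

  neg-+-cancelʳ : ∀ p q → ℚ.- (p ℚ.+ q) ℚ.+ q ≡ ℚ.- p
  neg-+-cancelʳ = solve 2 (λ p q → :- (p :+ q) :+ q := :- p) refl

  neg-involutive : ∀ p → ℚ.- (ℚ.- p) ≡ p
  neg-involutive = solve 1 (λ p → :- (:- p) := p) refl

-- A relation rather than an operation, so that it applies directly to reals such as `value 0ℤ -1ℤ`,
-- whose terms are negatives only after simplification.
_≗-_ : ℝ → ℝ → Set
x′ ≗- x = ∀ n → seq x′ n ≡ ℚ.- seq x n

≗--sym : ∀ {x x′} → x′ ≗- x → x ≗- x′
≗--sym {x} x′≗-x n = sym (trans (cong ℚ.-_ (x′≗-x n)) (neg-involutive (seq x n)))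

-- The same gap `ε` and index `N` serve: negate `x + ε ≤ y` termwise and add `ε` to both sides.
neg-antimono-< : ∀ {x x′ y y′} → x′ ≗- x → y′ ≗- y → x < y → y′ < x′
neg-antimono-< {x} {x′} {y} {y′} x′≗-x y′≗-y (ε , ε>0 , N , x+ε≤y) =
  ε , ε>0 , N , λ n N≤n → begin
    seq y′ n ℚ.+ ε               ≡⟨ cong (ℚ._+ ε) (y′≗-y n) ⟩
    ℚ.- seq y n ℚ.+ ε            ≤⟨ ℚₚ.+-monoˡ-≤ ε (ℚₚ.neg-antimono-≤ (x+ε≤y n N≤n)) ⟩
    ℚ.- (seq x n ℚ.+ ε) ℚ.+ ε    ≡⟨ neg-+-cancelʳ (seq x n) ε ⟩
    ℚ.- seq x n                  ≡⟨ x′≗-x n ⟨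
    seq x′ n                     ∎
  where open ℚₚ.≤-Reasoning

neg-antimono-≤ : ∀ {x x′ y y′} → x′ ≗- x → y′ ≗- y → x ≤ y → y′ ≤ x′
neg-antimono-≤ {x} {x′} {y} {y′} x′≗-x y′≗-y x≤y x′<y′ =
  x≤y (neg-antimono-< {x′} {x} {y′} {y} (≗--sym {x} {x′} x′≗-x) (≗--sym {y} {y′} y′≗-y) x′<y′)

lemma4 : (r₀ r₁ : ℝ) →
    let Region₁ = (fromℤ -[1+ 1 ] < r₀ × r₀ ≤ fromℤ -1ℤ) × (fromℤ -1ℤ < r₁ × r₁ ≤ fromℤ 0ℤ)
        Region₂ = (fromℤ -1ℤ ≤ r₀ × r₀ < fromℤ 0ℤ) × (fromℤ 0ℤ ≤ r₁ × r₁ < fromℤ 1ℤ)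
    in (Region₁ → IsCycle (r₀ , r₁) (0ℤ ∷ -1ℤ ∷ []))
     × (Region₂ → IsCycle (r₀ , r₁) (0ℤ ∷ 1ℤ ∷ []))
     × (Region₁ ⊎ Region₂ → (r₀ , r₁) ∉ 𝒟₂⁽*⁾)
lemma4 r₀ r₁ = cycle₁ , cycle₂ , λ
  { (inj₁ region₁) → nonzero-cycle⇒∉𝒟₂⁽*⁾ (r₀ , r₁) (0ℤ ∷ -1ℤ ∷ []) (suc zero) (λ ()) (cycle₁ region₁)
  ; (inj₂ region₂) → nonzero-cycle⇒∉𝒟₂⁽*⁾ (r₀ , r₁) (0ℤ ∷ 1ℤ ∷ []) (suc zero) (λ ()) (cycle₂ region₂) }
  where
  value : ℤ → ℤ → ℝ
  value a₀ a₁ = r₀ * fromℤ a₀ + r₁ * fromℤ a₁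

  cycle₁ : (fromℤ -[1+ 1 ] < r₀ × r₀ ≤ fromℤ -1ℤ) × (fromℤ -1ℤ < r₁ × r₁ ≤ fromℤ 0ℤ) →
    IsCycle (r₀ , r₁) (0ℤ ∷ -1ℤ ∷ [])
  cycle₁ ((-2<r₀ , r₀≤-1) , (-1<r₁ , r₁≤0)) = swap⇒cycle (r₀ , r₁)
    -- The value is `- r₁`. Negation turns the interval (-1, 0] into [0, 1), so the floor is 0 and
    -- the next entry is 0.
    (refl , 0ℤ ,
      ( neg-antimono-≤ {r₁} {value 0ℤ -1ℤ} {fromℤ 0ℤ} {fromℤ 0ℤ} -r₁ (λ _ → refl) r₁≤0
      , neg-antimono-< {fromℤ -1ℤ} {fromℤ 1ℤ} {r₁} {value 0ℤ -1ℤ} (λ _ → refl) -r₁ -1<r₁ ) ,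
      refl)
    -- The value is `- r₀`, which lies in [1, 2), so the floor is 1 and the next entry is -1.
    (refl , 1ℤ ,
      ( neg-antimono-≤ {r₀} {value -1ℤ 0ℤ} {fromℤ -1ℤ} {fromℤ 1ℤ} -r₀ (λ _ → refl) r₀≤-1
      , neg-antimono-< {fromℤ -[1+ 1 ]} {fromℤ (ℤ.+ 2)} {r₀} {value -1ℤ 0ℤ} (λ _ → refl) -r₀ -2<r₀ ) ,
      refl)
    where
    -r₁ : value 0ℤ -1ℤ ≗- r₁
    -r₁ n = *0+*-1 (seq r₀ n) (seq r₁ n)
    -r₀ : value -1ℤ 0ℤ ≗- r₀
    -r₀ n = *-1+*0 (seq r₀ n) (seq r₁ n)

  cycle₂ : (fromℤ -1ℤ ≤ r₀ × r₀ < fromℤ 0ℤ) × (fromℤ 0ℤ ≤ r₁ × r₁ < fromℤ 1ℤ) →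
    IsCycle (r₀ , r₁) (0ℤ ∷ 1ℤ ∷ [])
  -- Since `ℤ.suc -1ℤ` and `ℤ.suc 0ℤ` compute to 0 and 1, the two pairs of bounds are literally
  -- `IsFloor r₀ -1ℤ` and `IsFloor r₁ 0ℤ`.
  cycle₂ (⌊r₀⌋≡-1 , ⌊r₁⌋≡0) = swap⇒cycle (r₀ , r₁)
    (refl , 0ℤ , IsFloor-resp-≗ {r₁} {value 0ℤ 1ℤ} {0ℤ}
      (λ n → sym (*0+*1 (seq r₀ n) (seq r₁ n))) ⌊r₁⌋≡0 , refl)
    (refl , -1ℤ , IsFloor-resp-≗ {r₀} {value 1ℤ 0ℤ} { -1ℤ}
      (λ n → sym (*1+*0 (seq r₀ n) (seq r₁ n))) ⌊r₀⌋≡-1 , refl)
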